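{- Let $d\ge 2$ be an integer and let $G$ be a connected $d$-regular bipartite graph. Then $$\gamma_d^{\mathrm L}(G\square K_2)=2\,\gamma(G).$$
   Context: All graphs are finite and simple; $N_G(u)$ is the open neighborhood of $u$ in $G$, and $K_2$ is the complete graph on two vertices. A set $D\subseteq V(G)$ is a dominating set if every vertex of $V(G)\setminus D$ has a neighbor in $D$; $\gamma(G)$ is the minimum cardinality of a dominating set of $G$. For an integer $k\ge 0$, a dominating set $D$ of $G$ is a $k$-limited dominating set if $|N_G(u)\setminus D|\le k$ for every $u\in D$. The $k$-limited domination number $\gamma_k^{\mathrm L}(G)$ is the minimum cardinality of a $k$-limited dominating set of $G$. The Cartesian product $G\square H$ has vertex set $V(G)\times V(H)$, with $(g,h)$ and $(g',h')$ adjacent if and only if either $g=g'$ and $hh'\in E(H)$, or $h=h'$ and $gg'\in E(G)$. -}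

module Defs where

open import Data.Fin using (Fin; remQuot)
open import Data.Fin.Properties using (all?; any?; _≟_)
open import Data.Fin.Subset using (Subset; ⊤; ⊥; ∁; _∈_; _∉_; _─_; ∣_∣)
open import Data.Fin.Subset.Properties
  using (_∈?_; ∈⊤; anySubset?; p─⊤≡⊥; ∣⊥∣≡0)
open import Data.Nat using (ℕ; _*_; _≤_; _<_; _≤?_; _<?_; z≤n)
open import Data.Nat.Induction using (Acc; acc; <-wellFounded)
open import Data.Nat.Properties using (≮⇒≥; module ≤-Reasoning)
open import Data.Product using (∃; _×_; _,_; proj₁)
open import Data.Sum using (_⊎_; inj₁; inj₂)
open import Data.Vec using (tabulate)
open import Level using (0ℓ)
open import Relation.Binary.Construct.Closure.ReflexiveTransitive using (Star)
open import Relation.Binary.Core using (Rel)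
open import Relation.Binary.Definitions
  using (Decidable; Irreflexive; Symmetric)
open import Relation.Binary.PropositionalEquality
  using (_≡_; _≢_; refl; sym; cong; ≢-sym)
open import Relation.Nullary using (¬_; yes; no; does; contradiction)
open import Relation.Nullary.Decidable using (¬?; _×-dec_; _⊎-dec_; _→-dec_)
import Relation.Unary as U

record Graph (n : ℕ) : Set₁ where
  field
    Adj    : Rel (Fin n) 0ℓ
    adj?   : Decidable Adj
    symm   : Symmetric Adj
    irrefl : Irreflexive _≡_ Adj

  N : Fin n → Subset n
  N u = tabulate (λ v → does (adj? u v))

open Graph public

private
  variable
    m n : ℕ

K : (n : ℕ) → Graph n
K n = record
  { Adj    = _≢_
  ; adj?   = λ u v → ¬? (u ≟ v)
  ; symm   = ≢-sym
  ; irrefl = λ u≡v u≢v → u≢v u≡v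
  }

-- The vertex set Fin m × Fin n is represented by Fin (m * n), through the
-- bijection remQuot n : Fin (m * n) → Fin m × Fin n with inverse combine.
infixr 7 _□_

_□_ : Graph m → Graph n → Graph (m * n)
_□_ {m} {n} G H = record
  { Adj    = λ x y → Adj□ (remQuot n x) (remQuot n y)
  ; adj?   = λ x y → adj□? (remQuot n x) (remQuot n y)
  ; symm   = λ {x} {y} → symm□ (remQuot n x) (remQuot n y)
  ; irrefl = λ { {x} refl → irrefl□ (remQuot n x) }
  }
  where
  Adj□ : Rel (Fin m × Fin n) 0ℓ
  Adj□ (g , h) (g′ , h′) = (g ≡ g′ × Adj H h h′) ⊎ (h ≡ h′ × Adj G g g′)

  adj□? : Decidable Adj□
  adj□? (g , h) (g′ , h′) =
    (g ≟ g′ ×-dec adj? H h h′) ⊎-dec (h ≟ h′ ×-dec adj? G g g′)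

  symm□ : ∀ x y → Adj□ x y → Adj□ y x
  symm□ _ _ (inj₁ (p , e)) = inj₁ (sym p , symm H e)
  symm□ _ _ (inj₂ (p , e)) = inj₂ (sym p , symm G e)

  irrefl□ : ∀ x → ¬ Adj□ x x
  irrefl□ _ (inj₁ (_ , e)) = irrefl H refl e
  irrefl□ _ (inj₂ (_ , e)) = irrefl G refl e

-- The graph without vertices is not connected.
Connected : Graph n → Set
Connected {n} G = Fin n × (∀ u v → Star (Adj G) u v)

Regular : ℕ → Graph n → Set
Regular d G = ∀ u → ∣ N G u ∣ ≡ d

Independent : Graph n → Subset n → Set
Independent G X = ∀ {u v} → u ∈ X → v ∈ X → ¬ Adj G u v

Bipartite : Graph n → Set
Bipartite G = ∃ λ X → Independent G X × Independent G (∁ X)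

Dominating : Graph n → Subset n → Set
Dominating G D = ∀ u → u ∉ D → ∃ λ v → v ∈ D × Adj G u v

LimitedDominating : ℕ → Graph n → Subset n → Set
LimitedDominating k G D =
  Dominating G D × (∀ u → u ∈ D → ∣ N G u ─ D ∣ ≤ k)

dominating? : (G : Graph n) → U.Decidable (Dominating G)
dominating? G D =
  all? λ u → ¬? (u ∈? D) →-dec any? λ v → (v ∈? D) ×-dec adj? G u v

limitedDominating? : ∀ k (G : Graph n) → U.Decidable (LimitedDominating k G)
limitedDominating? k G D =
  dominating? G D ×-dec
  all? λ u → (u ∈? D) →-dec (∣ N G u ─ D ∣ ≤? k)

⊤-dominating : (G : Graph n) → Dominating G ⊤
⊤-dominating G u u∉⊤ = contradiction ∈⊤ u∉⊤

⊤-limitedDominating : ∀ k (G : Graph n) → LimitedDominating k G ⊤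
⊤-limitedDominating {n} k G = ⊤-dominating G , λ u _ → bound u
  where
  open ≤-Reasoning
  bound : ∀ u → ∣ N G u ─ ⊤ ∣ ≤ k
  bound u = begin
    ∣ N G u ─ ⊤ ∣          ≡⟨ cong ∣_∣ (p─⊤≡⊥ (N G u)) ⟩
    ∣ ⊥ {n} ∣              ≡⟨ ∣⊥∣≡0 n ⟩
    0                      ≤⟨ z≤n ⟩
    k                      ∎

SmallestWith : (Subset n → Set) → Set
SmallestWith P = ∃ λ D → P D × (∀ E → P E → ∣ D ∣ ≤ ∣ E ∣)

smallest : {P : Subset n → Set} → U.Decidable P → U.Satisfiable P → SmallestWith P
smallest {n} {P} P? (D₀ , pD₀) = descend D₀ pD₀ (<-wellFounded ∣ D₀ ∣)
  where
  descend : ∀ D → P D → Acc _<_ ∣ D ∣ → SmallestWith P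
  descend D pD (acc rs) with anySubset? (λ E → P? E ×-dec (∣ E ∣ <? ∣ D ∣))
  ... | yes (E , pE , E<D) = descend E pE (rs E<D)
  ... | no ∄E = D , pD , λ E pE → ≮⇒≥ λ E<D → ∄E (E , pE , E<D)

γ : Graph n → ℕ
γ G = ∣ proj₁ (smallest (dominating? G) (⊤ , ⊤-dominating G)) ∣

γᴸ : ℕ → Graph n → ℕ
γᴸ k G =
  ∣ proj₁ (smallest (limitedDominating? k G) (⊤ , ⊤-limitedDominating k G)) ∣

{-# OPTIONS --safe #-}
-- As G □ K₂ is (d+1)-regular, its d-limited dominating sets are its total
-- dominating sets. Two copies of a dominating set of G form one. Conversely, a
-- proper 2-colouring f of G splits V(G □ K₂) into the graph of f and the graph of
-- its complementary colouring. All neighbours of (u , opposite (f u)) lie on the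
-- graph of f, so a total dominating set cuts out of each of these two graphs a
-- dominating set of G.
module Submission where

open import Defs
open import Data.Fin using (Fin; zero; suc; combine; opposite; remQuot)
open import Data.Fin.Properties
  using (combine-surjective; remQuot-combine; opposite-involutive)
open import Data.Fin.Subset
  using (Subset; inside; outside; ⁅_⁆; _∈_; _∩_; _─_; ∣_∣; Nonempty)
open import Data.Fin.Subset.Properties
  using ( _∈?_; nonempty?; ⊆-antisym; x∈⁅x⁆; x∈⁅y⁆⇒x≡y; ∣⁅x⁆∣≡1; p⊆q⇒∣p∣≤∣q∣
        ; x∈p∩q⁺; x∈p∩q⁻; x∈p∧x∉q⇒x∈p─q; p∩q≢∅⇒∣p─q∣<∣p∣; x∉p⇒x∈∁p)
open import Data.Nat using (ℕ; suc; _+_; _*_; _≤_; _<_; s≤s; s≤s⁻¹)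
open import Data.Nat.Properties
  using (+-comm; +-suc; +-identityʳ; +-mono-≤; ≤-antisym; <⇒≱; module ≤-Reasoning)
open import Data.Product using (∃; _×_; _,_; proj₁; proj₂)
open import Data.Sum using (_⊎_; inj₁; inj₂)
open import Data.Vec using ([]; _∷_; lookup; tabulate)
open import Data.Vec.Properties using ([]=⇒lookup; lookup⇒[]=; lookup∘tabulate)
open import Function using (_∘_; const; _⇔_; mk⇔; Equivalence)
open import Relation.Binary.PropositionalEquality
  using ( _≡_; _≢_; refl; sym; trans; cong; cong₂; subst; subst₂
        ; module ≡-Reasoning)
open import Relation.Nullary using (does; yes; no; contradiction)
open import Relation.Nullary.Decidable using (dec-true; decidable-stable)

open Equivalence using (to; from)

private
  variable
    m n d : ℕ

-- Membership in neighbourhoods and adjacency in products.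

∈-tabulate : ∀ {φ : Fin n → _} {u} → u ∈ tabulate φ ⇔ φ u ≡ inside
∈-tabulate {φ = φ} {u} = mk⇔
  (λ u∈ → trans (sym (lookup∘tabulate φ u)) ([]=⇒lookup u∈))
  (λ φu → lookup⇒[]= u _ (trans (lookup∘tabulate φ u) φu))

∈-N : (G : Graph n) {u v : Fin n} → v ∈ N G u ⇔ Adj G u v
∈-N G {u} {v} = mk⇔ (to′ ∘ to ∈-tabulate) (from ∈-tabulate ∘ dec-true (adj? G u v))
  where
  to′ : does (adj? G u v) ≡ inside → Adj G u v
  to′ eq with adj? G u v
  to′ eq | yes e = e
  to′ () | no _

Adj-combine : (G : Graph m) (H : Graph n) → ∀ {u v i j} →
  Adj (G □ H) (combine u i) (combine v j) ⇔
  ((u ≡ v × Adj H i j) ⊎ (i ≡ j × Adj G u v))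
Adj-combine {m} {n} G H {u} {v} {i} {j} = mk⇔
  (subst₂ Adj□ (remQuot-combine u i) (remQuot-combine v j))
  (subst₂ Adj□ (sym (remQuot-combine u i)) (sym (remQuot-combine v j)))
  where
  -- A copy of the relation local to `_□_`, named so that `subst₂` has a motive.
  Adj□ : Fin m × Fin n → Fin m × Fin n → Set
  Adj□ (g , h) (g′ , h′) = (g ≡ g′ × Adj H h h′) ⊎ (h ≡ h′ × Adj G g g′)

-- Limited and total domination in regular graphs.

TotalDominating : Graph n → Subset n → Set
TotalDominating G D = ∀ u → ∃ λ v → v ∈ D × Adj G u v

∣p─q∣<∣p∣⇔Nonempty : (p q : Subset n) → ∣ p ─ q ∣ < ∣ p ∣ ⇔ Nonempty (p ∩ q)
∣p─q∣<∣p∣⇔Nonempty p q = mk⇔ meets (p∩q≢∅⇒∣p─q∣<∣p∣ p q)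
  where
  meets : ∣ p ─ q ∣ < ∣ p ∣ → Nonempty (p ∩ q)
  meets lt = decidable-stable (nonempty? (p ∩ q)) λ empty →
    -- If `p` and `q` were disjoint, `p` would be contained in `p ─ q`, against `lt`.
    <⇒≱ lt (p⊆q⇒∣p∣≤∣q∣ λ x∈p →
      x∈p∧x∉q⇒x∈p─q x∈p λ x∈q → empty (_ , x∈p∩q⁺ (x∈p , x∈q)))

-- Of d + 1 neighbours, at most d lie outside `D` exactly when some neighbour lies inside. This
-- settles the vertices of `D`; plain domination settles the others.
limitedDominating⇔totalDominating : (G : Graph n) → Regular (suc d) G →
  ∀ D → LimitedDominating d G D ⇔ TotalDominating G D
limitedDominating⇔totalDominating {d = d} G reg D = mk⇔ total limited
  where
  total : LimitedDominating d G D → TotalDominating G D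
  total (dom , lim) u with u ∈? D
  ... | no u∉D = dom u u∉D
  ... | yes u∈D
    with v , v∈ ← to (∣p─q∣<∣p∣⇔Nonempty (N G u) D)
                     (subst (∣ N G u ─ D ∣ <_) (sym (reg u)) (s≤s (lim u u∈D)))
    with v∈N , v∈D ← x∈p∩q⁻ (N G u) D v∈ = v , v∈D , to (∈-N G) v∈N

  limited : TotalDominating G D → LimitedDominating d G D
  limited tot = (λ u _ → tot u) , λ u _ →
    let v , v∈D , u~v = tot u in
    s≤s⁻¹ (subst (∣ N G u ─ D ∣ <_) (reg u)
      (from (∣p─q∣<∣p∣⇔Nonempty (N G u) D) (v , x∈p∩q⁺ (from (∈-N G) u~v , v∈D))))

-- Graphs of maps into a two-point fibre.

i≢opposite : (i : Fin 2) → i ≢ opposite i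
i≢opposite zero ()
i≢opposite (suc zero) ()

≢⇒≡opposite : {i j : Fin 2} → i ≢ j → j ≡ opposite i
≢⇒≡opposite {zero} {zero} i≢j = contradiction refl i≢j
≢⇒≡opposite {zero} {suc zero} _ = refl
≢⇒≡opposite {suc zero} {zero} _ = refl
≢⇒≡opposite {suc zero} {suc zero} i≢j = contradiction refl i≢j

-- The part of `D` on the graph of `f`, projected to the first factor. For constant `f` it is a
-- layer of `D`.
along : (Fin m → Fin n) → Subset (m * n) → Subset m
along f D = tabulate λ u → lookup D (combine u (f u))

∈-along : (f : Fin m → Fin n) (D : Subset (m * n)) {u : Fin m} →
  u ∈ along f D ⇔ combine u (f u) ∈ D
∈-along f D = mk⇔ (lookup⇒[]= _ D ∘ to ∈-tabulate) (from ∈-tabulate ∘ []=⇒lookup)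

-- Of the two points over each vertex, one is on the graph of `f` and the other on that of
-- `opposite ∘ f`.
∣along∣+∣along-opposite∣ : (f : Fin n → Fin 2) (D : Subset (n * 2)) →
  ∣ along f D ∣ + ∣ along (opposite ∘ f) D ∣ ≡ ∣ D ∣
∣along∣+∣along-opposite∣ {0} f [] = refl
∣along∣+∣along-opposite∣ {suc n} f (b ∷ c ∷ D)
  -- `b` and `c` are the entries over `zero`; `f zero` decides which of them counts in which
  -- summand. `+-suc` appears where the second summand grows.
  with f zero | b | c | ∣along∣+∣along-opposite∣ (f ∘ suc) D
... | zero     | outside | outside | ih = ih
... | zero     | outside | inside  | ih = trans (+-suc _ _) (cong suc ih)
... | zero     | inside  | outside | ih = cong suc ih
... | zero     | inside  | inside  | ih = cong suc (trans (+-suc _ _) (cong suc ih))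
... | suc zero | outside | outside | ih = ih
... | suc zero | outside | inside  | ih = cong suc ih
... | suc zero | inside  | outside | ih = trans (+-suc _ _) (cong suc ih)
... | suc zero | inside  | inside  | ih = cong suc (trans (+-suc _ _) (cong suc ih))

-- The neighbourhood of (u , i) has a copy of `N G u` in layer `i`, and only the twin of `u` in the
-- other layer.
□K₂-regular : (G : Graph n) → Regular d G → Regular (suc d) (G □ K 2)
□K₂-regular {n} {d} G reg x with u , i , refl ← combine-surjective {n} {2} x = begin
  ∣ Nₓ ∣                                  ≡⟨ ∣along∣+∣along-opposite∣ {n} (const i) Nₓ ⟨
  ∣ layer i ∣ + ∣ layer (opposite i) ∣    ≡⟨ cong₂ (λ p q → ∣ p ∣ + ∣ q ∣) same other ⟩
  ∣ N G u ∣ + ∣ ⁅ u ⁆ ∣                   ≡⟨ cong₂ _+_ (reg u) (∣⁅x⁆∣≡1 u) ⟩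
  d + 1                                   ≡⟨ +-comm d 1 ⟩
  suc d                                   ∎
  where
  open ≡-Reasoning
  Nₓ : Subset (n * 2)
  Nₓ = N (G □ K 2) (combine u i)

  layer : Fin 2 → Subset n
  layer j = along (const j) Nₓ

  ∈-layer : ∀ {j v} → v ∈ layer j ⇔ ((u ≡ v × i ≢ j) ⊎ (i ≡ j × Adj G u v))
  ∈-layer {j} = mk⇔
    (to (Adj-combine G (K 2)) ∘ to (∈-N (G □ K 2)) ∘ to (∈-along (const j) Nₓ))
    (from (∈-along (const j) Nₓ) ∘ from (∈-N (G □ K 2)) ∘ from (Adj-combine G (K 2)))

  same : layer i ≡ N G u
  same = ⊆-antisym
    (λ v∈ → from (∈-N G) (sameLayer (to ∈-layer v∈)))
    (λ v∈ → from ∈-layer (inj₂ (refl , to (∈-N G) v∈)))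
    where
    sameLayer : ∀ {v} → (u ≡ v × i ≢ i) ⊎ (i ≡ i × Adj G u v) → Adj G u v
    sameLayer (inj₁ (_ , i≢i)) = contradiction refl i≢i
    sameLayer (inj₂ (_ , u~v)) = u~v

  other : layer (opposite i) ≡ ⁅ u ⁆
  other = ⊆-antisym
    (λ v∈ → otherLayer (to ∈-layer v∈))
    (λ v∈ → from ∈-layer (inj₁ (sym (x∈⁅y⁆⇒x≡y u v∈) , i≢opposite i)))
    where
    otherLayer : ∀ {v} → (u ≡ v × i ≢ opposite i) ⊎ (i ≡ opposite i × Adj G u v) → v ∈ ⁅ u ⁆
    otherLayer (inj₁ (refl , _)) = x∈⁅x⁆ u
    otherLayer (inj₂ (i≡ , _)) = contradiction i≡ (i≢opposite i)

-- Lifting dominating sets of G to G □ K₂.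

cylinder : Subset m → Subset (m * n)
cylinder {n = n} D = tabulate λ x → lookup D (proj₁ (remQuot n x))

∈-cylinder : (D : Subset m) {u : Fin m} {i : Fin n} → combine u i ∈ cylinder D ⇔ u ∈ D
∈-cylinder {n = n} D {u} {i} = mk⇔
  (λ x∈ → lookup⇒[]= u D (trans (sym eq) (to ∈-tabulate x∈)))
  (λ u∈ → from ∈-tabulate (trans eq ([]=⇒lookup u∈)))
  where
  eq : lookup D (proj₁ (remQuot n (combine u i))) ≡ lookup D u
  eq = cong (lookup D ∘ proj₁) (remQuot-combine u i)

-- A cylinder contains all points over a vertex or none, so the choice made by `f` is immaterial.
along-cylinder : (f : Fin m → Fin n) (D : Subset m) → along f (cylinder D) ≡ D
along-cylinder f D = ⊆-antisym
  (to (∈-cylinder D) ∘ to (∈-along f (cylinder D)))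
  (from (∈-along f (cylinder D)) ∘ from (∈-cylinder D))

∣cylinder∣ : (D : Subset n) → ∣ cylinder {n = 2} D ∣ ≡ 2 * ∣ D ∣
∣cylinder∣ {n} D = begin
  ∣ cylinder D ∣                            ≡⟨ ∣along∣+∣along-opposite∣ bottom (cylinder D) ⟨
  ∣ along bottom (cylinder D) ∣ + ∣ along (opposite ∘ bottom) (cylinder D) ∣
    ≡⟨ cong₂ (λ p q → ∣ p ∣ + ∣ q ∣) (along-cylinder bottom D) (along-cylinder (opposite ∘ bottom) D) ⟩
  ∣ D ∣ + ∣ D ∣                             ≡⟨ cong (∣ D ∣ +_) (+-identityʳ _) ⟨
  2 * ∣ D ∣                                 ∎
  where
  open ≡-Reasoning
  bottom : Fin n → Fin 2
  bottom = const zero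

-- A vertex over `D` is adjacent to its twin, which is over `D` too; any other vertex has a suitable
-- neighbour in its own layer.
cylinder-totalDominating : (G : Graph n) {D : Subset n} →
  Dominating G D → TotalDominating (G □ K 2) (cylinder D)
cylinder-totalDominating {n} G {D} dom x
  with u , i , refl ← combine-surjective {n} {2} x with u ∈? D
... | yes u∈D = combine u (opposite i) , from (∈-cylinder D) u∈D ,
  from (Adj-combine G (K 2)) (inj₁ (refl , i≢opposite i))
... | no u∉D with v , v∈D , u~v ← dom u u∉D =
  combine v i , from (∈-cylinder D) v∈D ,
  from (Adj-combine G (K 2)) (inj₂ (refl , u~v))

-- Cutting total dominating sets along a 2-colouring.

Proper : Graph m → (Fin m → Fin n) → Set
Proper G f = ∀ {u v} → Adj G u v → f u ≢ f v

-- An involution is injective, so it keeps distinct colours distinct.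
opposite-proper : (G : Graph m) {f : Fin m → Fin n} → Proper G f → Proper G (opposite ∘ f)
opposite-proper G {f} proper {u} {v} u~v eq = proper u~v
  (trans (sym (opposite-involutive (f u)))
    (trans (cong opposite eq) (opposite-involutive (f v))))

bipartite⇒2-colouring : (G : Graph n) → Bipartite G → ∃ λ (f : Fin n → Fin 2) → Proper G f
bipartite⇒2-colouring {n} G (X , indX , ind∁X) = colour , proper
  where
  colour : Fin n → Fin 2
  colour u with u ∈? X
  ... | yes _ = zero
  ... | no _ = suc zero

  proper : Proper G colour
  proper {u} {v} u~v eq with u ∈? X | v ∈? X
  proper u~v eq | yes u∈X | yes v∈X = indX u∈X v∈X u~v
  proper u~v eq | no u∉X | no v∉X = ind∁X (x∉p⇒x∈∁p u∉X) (x∉p⇒x∈∁p v∉X) u~v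
  proper u~v () | yes _ | no _
  proper u~v () | no _ | yes _

along-dominating : (G : Graph n) (f : Fin n → Fin 2) → Proper G f →
  ∀ {D} → TotalDominating (G □ K 2) D → Dominating G (along f D)
along-dominating {n} G f proper {D} tot u u∉
  with y , y∈D , x~y ← tot (combine u (opposite (f u)))
  with v , j , refl ← combine-surjective {n} {2} y
  with to (Adj-combine G (K 2)) x~y
-- The edge inside the fibre ends at (u , f u), which would put `u` into `along f D`.
... | inj₁ (refl , opp≢j) = contradiction
  (from (∈-along f D) (subst (λ i → combine u i ∈ D) j≡fu y∈D)) u∉
  where
  j≡fu : j ≡ f u
  j≡fu = trans (≢⇒≡opposite opp≢j) (opposite-involutive (f u))
-- The edge inside a layer keeps the level `opposite (f u)`, which equals `f v` because `f` is
-- proper and there are only two colours.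
... | inj₂ (refl , u~v) = v , from (∈-along f D) v∈ , u~v
  where
  v∈ : combine v (f v) ∈ D
  v∈ = subst (λ i → combine v i ∈ D) (sym (≢⇒≡opposite (proper u~v))) y∈D

γ-minimal : (G : Graph n) {D : Subset n} → Dominating G D → γ G ≤ ∣ D ∣
γ-minimal G = proj₂ (proj₂ (smallest (dominating? G) _)) _

γᴸ-minimal : ∀ k (G : Graph n) {D : Subset n} → LimitedDominating k G D → γᴸ k G ≤ ∣ D ∣
γᴸ-minimal k G = proj₂ (proj₂ (smallest (limitedDominating? k G) _)) _

corollary18 : (d : ℕ) → 2 ≤ d →
    (n : ℕ) (G : Graph n) → Connected G → Regular d G → Bipartite G →
    γᴸ d (G □ K 2) ≡ 2 * γ G
corollary18 d _ n G _ reg bip = ≤-antisym upper lower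
  where
  open ≤-Reasoning
  limited⇔total : ∀ D → LimitedDominating d (G □ K 2) D ⇔ TotalDominating (G □ K 2) D
  limited⇔total = limitedDominating⇔totalDominating (G □ K 2) (□K₂-regular G reg)

  upper : γᴸ d (G □ K 2) ≤ 2 * γ G
  -- `D` is the set whose size defines `γ G`, so the match turns the bound into one on ∣ D ∣.
  upper with D , dom , _ ← smallest (dominating? G) (_ , ⊤-dominating G) = begin
    γᴸ d (G □ K 2) ≤⟨ γᴸ-minimal d (G □ K 2) (from (limited⇔total _) (cylinder-totalDominating G dom)) ⟩
    ∣ cylinder {n = 2} D ∣ ≡⟨ ∣cylinder∣ D ⟩
    2 * ∣ D ∣ ∎

  lower : 2 * γ G ≤ γᴸ d (G □ K 2)
  lower with f , proper ← bipartite⇒2-colouring G bip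
        with D , lim , _ ← smallest (limitedDominating? d (G □ K 2)) (_ , ⊤-limitedDominating d (G □ K 2)) = begin
    2 * γ G       ≡⟨ cong (γ G +_) (+-identityʳ _) ⟩
    -- One minimum set `D` of the product pays for two dominating sets of `G`, one for each of the
    -- complementary colourings.
    γ G + γ G     ≤⟨ +-mono-≤ (γ-minimal G (along-dominating G f proper tot))
                              (γ-minimal G (along-dominating G (opposite ∘ f) (opposite-proper G proper) tot)) ⟩
    ∣ along f D ∣ + ∣ along (opposite ∘ f) D ∣ ≡⟨ ∣along∣+∣along-opposite∣ f D ⟩
    ∣ D ∣ ∎
    where
    tot : TotalDominating (G □ K 2) D
    tot = to (limited⇔total D) lim
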